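{- Let $r>1$ be an integer and let $p_1=2<p_2<\cdots<p_r$ be distinct primes. Suppose further that $p_t-1\mid p_{t+1}-1$ for all integers $t$ with $0<t<r-1$, and that $p_r\geqslant(p_{r-1}-2)(p_{r-1}-3)$. Then $$p_1^{\frac{p_2-1}{p_1-1}-1}\cdots p_{r-2}^{\frac{p_{r-1}-1}{p_{r-2}-1}-1}\;p_{r-1}^{\left\lfloor\frac{p_r-1}{p_{r-1}-1}\right\rfloor}\;p_r$$ is a primitive covering number. (Here the factors $p_t^{\frac{p_{t+1}-1}{p_t-1}-1}$ run over $1\leqslant t\leqslant r-2$; there are none when $r=2$.)
   Context: For $a\in\mathbb{Z}$ and a positive integer $n$, $a(\mathrm{mod}\ n)=\{a+nx: x\in\mathbb{Z}\}$ is the residue class with modulus $n$. A finite system of residue classes $\{a_i(\mathrm{mod}\ n_i)\}_{i=1}^k$ is a cover of $\mathbb{Z}$ if every integer lies in at least one of the classes $a_i(\mathrm{mod}\ n_i)$. A positive integer $n$ is called a covering number if there is a cover of $\mathbb{Z}$ whose moduli are all distinct, greater than one, and divisors of $n$. A covering number is called a primitive covering number if none of its proper divisors (positive divisors smaller than the number itself) is a covering number. $\lfloor x\rfloor$ denotes the greatest integer not exceeding $x$. -}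

module Defs where

open import Data.Fin.Base using (Fin)
open import Data.Integer.Base as ℤ using (ℤ)
open import Data.List.Base using (applyUpTo)
open import Data.Nat.Base using (ℕ; zero; suc; _<_; _/_)
open import Data.Nat.Divisibility using (_∣_)
open import Data.Nat.ListAction using (product)
open import Data.Product.Base using (_×_; ∃; ∃-syntax)
open import Function.Base using (_∘_)
open import Function.Definitions using (Injective)
open import Relation.Binary.PropositionalEquality.Core using (_≡_)
open import Relation.Nullary.Negation.Core using (¬_)
open import Relation.Unary using (Pred; _∈_)
open import Level using (0ℓ)

infix 8 _[mod_]

_[mod_] : ℤ → ℕ → Pred ℤ 0ℓ
(a [mod n ]) z = ∃[ x ] z ≡ a ℤ.+ ℤ.+ n ℤ.* x

IsCover : ∀ {k} → (Fin k → ℤ) → (Fin k → ℕ) → Set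
IsCover a n = ∀ z → ∃[ i ] z ∈ a i [mod n i ]

CoveringNumber : Pred ℕ 0ℓ
CoveringNumber N =
  0 < N ×
  (∃[ k ] ∃ λ (a : Fin k → ℤ) → ∃ λ (n : Fin k → ℕ) →
    IsCover a n ×
    Injective _≡_ _≡_ n ×
    (∀ i → 1 < n i) ×
    (∀ i → n i ∣ N))

PrimitiveCoveringNumber : Pred ℕ 0ℓ
PrimitiveCoveringNumber N =
  CoveringNumber N × (∀ d → 0 < d → d < N → d ∣ N → ¬ CoveringNumber d)

-- The floor of m / n.  The value at n = 0 is a dummy; it lets n be an
-- expression such as p ∸ 1 whose positivity is only known from hypotheses.
⌊_÷_⌋ : ℕ → ℕ → ℕ
⌊ m ÷ zero ⌋  = 0
⌊ m ÷ suc n ⌋ = m / suc n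

-- f 1 * f 2 * ⋯ * f n; the index starts at 1.
∏₁ : ℕ → (ℕ → ℕ) → ℕ
∏₁ n f = product (applyUpTo (f ∘ suc) n)

{-# OPTIONS --safe #-}
module Submission where

-- Covering: if all but the multiples of M = m * p ^ i are covered, p ∤ m, and m has at least p - 1 divisors e,
-- the moduli e * p ^ (i + 1) cover all but one of the p subclasses of 0 (mod M), and all of them when m has at
-- least p divisors.  The exponents make the divisor count of the first s prime powers equal to p_{s+1} - 1
-- (s ≤ r - 2), and at least p_r for s = r - 1.
--
-- Primitivity: conversely, if m has fewer than p divisors and p ∤ m, a cover with moduli dividing m * p ^ i yields one
-- with moduli dividing m.  Removing the primes of a proper divisor from the largest down leaves 1, which is not
-- a covering number; the size condition on p_r ensures that proper divisors of the cofactor of p_r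
-- have fewer than p_r divisors.

open import Defs
open import Data.Empty using (⊥-elim)
open import Data.Fin.Base using (Fin; zero; suc; toℕ; fromℕ<; combine; remQuot; punchIn; punchOut)
open import Data.Fin.Properties
  using (any?; pigeonhole; toℕ<n; toℕ-fromℕ<; toℕ-injective; remQuot-combine; combine-remQuot
        ; punchIn-punchOut)
open import Data.Integer.Base as ℤ using (ℤ; +_; ∣_∣)
import Data.Integer.DivMod as ℤ
import Data.Integer.Properties as ℤ
import Data.Integer.Tactic.RingSolver as ℤ
open import Data.List.Base using (List; _∷_; _∷ʳ_; applyUpTo; filter; length; lookup; upTo)
open import Data.List.Membership.Propositional as List using ()
open import Data.List.Membership.Propositional.Properties using (∈-lookup; ∈-filter⁺; ∈-filter⁻; ∈-upTo⁺)
open import Data.List.Properties using (applyUpTo-∷ʳ)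
open import Data.List.Relation.Unary.All as All using ()
open import Data.List.Relation.Unary.Any using (index)
open import Data.List.Relation.Unary.Any.Properties using (lookup-index)
open import Data.List.Relation.Unary.AllPairs using (_∷_)
open import Data.List.Relation.Unary.Unique.Propositional using (Unique)
open import Data.List.Relation.Unary.Unique.Propositional.Properties using (filter⁺; upTo⁺)
open import Data.Nat.Base
  using (ℕ; zero; suc; _+_; _*_; _∸_; _^_; _≤_; _<_; _≥_; _>_; z≤n; s≤s; NonZero; >-nonZero; ≢-nonZero
        ; nonTrivial⇒n>1; _%_)
open import Data.Nat.Coprimality using (Coprime; coprime-divisor)
open import Data.Nat.Divisibility
open import Data.Nat.DivMod using (m/n*n≡m; m≡m%n+[m/n]*n; m%n<n)
open import Data.Nat.ListAction using (product)
open import Data.Nat.ListAction.Properties using (product-++)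
open import Data.Nat.Primality
  using (Prime; euclidsLemma; prime⇒irreducible; prime⇒nonZero; prime⇒nonTrivial; ¬prime[0]; ¬prime[1])
open import Data.Nat.Properties
import Data.Nat.Tactic.RingSolver as ℕ
open import Data.Product.Base using (_×_; _,_; ∃; ∃₂; proj₁; proj₂)
open import Data.Sum.Base using (_⊎_; inj₁; inj₂)
open import Function.Base using (_∘_)
open import Function.Definitions using (Injective)
open import Relation.Binary.PropositionalEquality
  using (_≡_; _≢_; refl; sym; trans; cong; cong₂; subst; subst₂; module ≡-Reasoning)
open import Relation.Nullary using (¬_; yes; no; contradiction)
open import Relation.Nullary.Decidable using (_×-dec_)
open import Relation.Unary using (_∈_)

-- Covers as assignments of a residue to every modulus

CoveredBy : (ℕ → ℤ) → ℕ → ℤ → Set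
CoveredBy a N z = ∃ λ n → 1 < n × n ∣ N × z ∈ a n [mod n ]

-- A system with distinct moduli is the same as a choice of one residue a n for every modulus n; residues
-- for unused moduli only help.
HasCover : ℕ → Set
HasCover N = ∃ λ a → ∀ z → CoveredBy a N z

lookup-injective : ∀ {xs : List ℕ} → Unique xs → Injective _≡_ _≡_ (lookup xs)
lookup-injective (x∉ ∷ u) {zero}  {zero}  _  = refl
lookup-injective (x∉ ∷ u) {zero}  {suc j} eq = contradiction eq (All.lookup x∉ (∈-lookup j))
lookup-injective (x∉ ∷ u) {suc i} {zero}  eq = contradiction (sym eq) (All.lookup x∉ (∈-lookup i))
lookup-injective (x∉ ∷ u) {suc i} {suc j} eq = cong suc (lookup-injective u eq)

hasCover⇒covering : ∀ {N} → 0 < N → HasCover N → CoveringNumber N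
hasCover⇒covering {N} 0<N (a , cover) =
  0<N , length moduli , a ∘ lookup moduli , lookup moduli , covers ,
  lookup-injective (filter⁺ admissible? (upTo⁺ (suc N))) ,
  (λ i → proj₁ (admissible i)) , (λ i → proj₂ (admissible i))
  where
  admissible? = λ n → (1 <? n) ×-dec (n ∣? N)
  -- `upTo` excludes its bound, so `suc N` is what keeps the divisor `N` itself.
  moduli = filter admissible? (upTo (suc N))

  admissible : ∀ i → 1 < lookup moduli i × lookup moduli i ∣ N
  admissible i = proj₂ (∈-filter⁻ admissible? {xs = upTo (suc N)} (∈-lookup {xs = moduli} i))

  covers : IsCover (a ∘ lookup moduli) (lookup moduli)
  covers z with n , 1<n , n∣N , z∈ ← cover z =
    index n∈ , subst (λ m → z ∈ a m [mod m ]) (lookup-index n∈) z∈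
    where
    n∈ : n List.∈ moduli
    n∈ = ∈-filter⁺ admissible? (∈-upTo⁺ (s≤s (∣⇒≤ {{>-nonZero 0<N}} n∣N))) (1<n , n∣N)

covering⇒hasCover : ∀ {N} → CoveringNumber N → HasCover N
covering⇒hasCover {N} (_ , k , a , n , cover , n-inj , 1<n , n∣N) = b , covers
  where
  b : ℕ → ℤ
  b m with any? (λ i → n i ≟ m)
  ... | yes (i , _) = a i
  ... | no  _       = + 0

  b∘n : ∀ i → b (n i) ≡ a i
  b∘n i with any? (λ j → n j ≟ n i)
  ... | yes (j , eq) = cong a (n-inj eq)
  ... | no  ¬∃       = contradiction (i , refl) ¬∃

  covers : ∀ z → CoveredBy b N z
  covers z with i , z∈ ← cover z =
    n i , 1<n i , n∣N i , subst (λ c → z ∈ c [mod n i ]) (sym (b∘n i)) z∈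

1-hasNoCover : ¬ HasCover 1
1-hasNoCover (a , cover) with n , 1<n , n∣1 , _ ← cover (+ 0) = <-irrefl (sym (∣1⇒≡1 n∣1)) 1<n

-- Divisors of m * p ^ i

^-monoʳ-∣ : ∀ p {i j} → i ≤ j → p ^ i ∣ p ^ j
^-monoʳ-∣ p {i} {j} i≤j =
  subst (p ^ i ∣_) (trans (sym (^-distribˡ-+-* p i (j ∸ i))) (cong (p ^_) (m+[n∸m]≡n i≤j))) (m∣m*n (p ^ (j ∸ i)))

∤⇒coprime : ∀ {p d} → Prime p → p ∤ d → Coprime d p
∤⇒coprime pp p∤d (c∣d , c∣p) with prime⇒irreducible pp c∣p
... | inj₁ c≡1  = c≡1
... | inj₂ refl = contradiction c∣d p∤d

∣m*p^i : ∀ {p} → Prime p → ∀ {d} m i → d ∣ m * p ^ i →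
         ∃₂ λ e j → e ∣ m × j ≤ i × d ≡ e * p ^ j
∣m*p^i {p} pp {d} m zero d∣ =
  d , 0 , subst (d ∣_) (*-identityʳ m) d∣ , z≤n , sym (*-identityʳ d)
∣m*p^i {p} pp {d} m (suc i) d∣ with p ∣? d
... | yes (divides k refl) =
  let e , j , e∣m , j≤i , k≡ = ∣m*p^i pp {k} m i (*-cancelʳ-∣ p {{prime⇒nonZero pp}} (subst (k * p ∣_) (swap m p (p ^ i)) d∣))
  in e , suc j , e∣m , s≤s j≤i , trans (cong (_* p) k≡) (sym (swap e p (p ^ j)))
  where
  swap : ∀ x y z → x * (y * z) ≡ x * z * y
  swap = ℕ.solve-∀
... | no p∤d =
  let e , j , e∣m , j≤i , d≡ = ∣m*p^i pp m i (coprime-divisor (∤⇒coprime pp p∤d) (subst (d ∣_) (swap m p (p ^ i)) d∣))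
  in e , j , e∣m , m≤n⇒m≤1+n j≤i , d≡
  where
  swap : ∀ x y z → x * (y * z) ≡ y * (x * z)
  swap = ℕ.solve-∀

-- The two bounds are separate listings: the pigeonhole argument needs one that misses no divisor,
-- the construction of classes one that repeats none.
AtMostDivisors : ℕ → ℕ → Set
AtMostDivisors m n = ∃ λ (f : Fin n → ℕ) → ∀ {d} → d ∣ m → ∃ λ i → f i ≡ d

AtLeastDivisors : ℕ → ℕ → Set
AtLeastDivisors m n = ∃ λ (f : Fin n → ℕ) → Injective _≡_ _≡_ f × (∀ i → f i ∣ m)

atMost-∣ : ∀ {e m n} → e ∣ m → AtMostDivisors m n → AtMostDivisors e n
atMost-∣ e∣m (f , complete) = f , λ d∣e → complete (∣-trans d∣e e∣m)

-- `m` is listed but does not divide its proper divisor `e`, so its index can be skipped.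
atMost-proper : ∀ {e m n} → 0 < m → e ∣ m → e ≢ m → AtMostDivisors m n → AtMostDivisors e (n ∸ 1)
atMost-proper {n = zero} _ _ _ (f , complete) with () ← proj₁ (complete ∣-refl)
atMost-proper {e} {m} {suc n} 0<m e∣m e≢m (f , complete) with i₀ , fi₀≡m ← complete ∣-refl =
  f ∘ punchIn i₀ , complete′
  where
  complete′ : ∀ {d} → d ∣ e → ∃ λ i → f (punchIn i₀ i) ≡ d
  complete′ {d} d∣e with i , fi≡d ← complete (∣-trans d∣e e∣m) =
    punchOut i₀≢i , trans (cong f (punchIn-punchOut i₀≢i)) fi≡d
    where
    i₀≢i : i₀ ≢ i
    i₀≢i refl = e≢m (∣-antisym e∣m (subst (_∣ e) (trans (sym fi≡d) fi₀≡m) d∣e))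

atMost-*^ : ∀ {p m n} → Prime p → ∀ i → AtMostDivisors m n → AtMostDivisors (m * p ^ i) (n * suc i)
atMost-*^ {p} {m} {n} pp i (f , complete) = g ∘ remQuot (suc i) , complete′
  where
  g : Fin n × Fin (suc i) → ℕ
  g (k , j) = f k * p ^ toℕ j

  complete′ : ∀ {d} → d ∣ m * p ^ i → ∃ λ l → g (remQuot (suc i) l) ≡ d
  complete′ d∣ with e , j , e∣m , j≤i , refl ← ∣m*p^i pp m i d∣ with k , fk≡e ← complete e∣m =
    combine k (fromℕ< (s≤s j≤i)) ,
    trans (cong g (remQuot-combine k _)) (cong₂ (λ x y → x * p ^ y) fk≡e (toℕ-fromℕ< (s≤s j≤i)))

*^-injective : ∀ {p} → Prime p → ∀ {e e′} → p ∤ e → p ∤ e′ → ∀ i j →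
               e * p ^ i ≡ e′ * p ^ j → e ≡ e′ × i ≡ j
*^-injective {p} pp {e} {e′} p∤e p∤e′ zero zero eq =
  trans (sym (*-identityʳ e)) (trans eq (*-identityʳ e′)) , refl
*^-injective {p} pp {e} {e′} p∤e p∤e′ zero (suc j) eq =
  contradiction (subst (p ∣_) (trans (sym eq) (*-identityʳ e)) (∣n⇒∣m*n e′ (m∣m*n (p ^ j)))) p∤e
*^-injective {p} pp {e} {e′} p∤e p∤e′ (suc i) zero eq =
  contradiction (subst (p ∣_) (trans eq (*-identityʳ e′)) (∣n⇒∣m*n e (m∣m*n (p ^ i)))) p∤e′
*^-injective {p} pp {e} {e′} p∤e p∤e′ (suc i) (suc j) eq =
  let e≡e′ , i≡j = *^-injective pp p∤e p∤e′ i j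
                     (*-cancelˡ-≡ _ _ p {{prime⇒nonZero pp}} (trans (swap p e (p ^ i)) (trans eq (sym (swap p e′ (p ^ j))))))
  in e≡e′ , cong suc i≡j
  where
  swap : ∀ x y z → x * (y * z) ≡ y * (x * z)
  swap = ℕ.solve-∀

atLeast-*^ : ∀ {p m n} → Prime p → p ∤ m → ∀ i → AtLeastDivisors m n → AtLeastDivisors (m * p ^ i) (n * suc i)
atLeast-*^ {p} {m} {n} pp p∤m i (f , f-inj , f∣m) = g ∘ remQuot (suc i) , inj , divs
  where
  g : Fin n × Fin (suc i) → ℕ
  g (k , j) = f k * p ^ toℕ j

  p∤f : ∀ k → p ∤ f k
  p∤f k p∣fk = p∤m (∣-trans p∣fk (f∣m k))

  inj : Injective _≡_ _≡_ (g ∘ remQuot (suc i))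
  inj {x} {y} eq =
    let k , j = remQuot {n} (suc i) x ; k′ , j′ = remQuot {n} (suc i) y
        e , t = *^-injective pp (p∤f k) (p∤f k′) (toℕ j) (toℕ j′) eq
    in trans (sym (combine-remQuot {n} (suc i) x))
             (trans (cong₂ combine (f-inj e) (toℕ-injective t)) (combine-remQuot {n} (suc i) y))

  divs : ∀ x → g (remQuot (suc i) x) ∣ m * p ^ i
  divs x = let k , j = remQuot {n} (suc i) x
           in *-pres-∣ (f∣m k) (^-monoʳ-∣ p (≤-pred (toℕ<n j)))


-- Lets `reduce` avoid deciding whether `z` is covered: either some translate shows that it is, or
-- every translate yields a modulus divisible by the top power of `p`.
all⊎ : ∀ {n} {A : Set} {B : Fin n → Set} → (∀ i → A ⊎ B i) → A ⊎ (∀ i → B i)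
all⊎ {zero}  f = inj₂ λ ()
all⊎ {suc n} f with f zero | all⊎ (f ∘ suc)
... | inj₁ a | _      = inj₁ a
... | inj₂ _ | inj₁ a = inj₁ a
... | inj₂ b | inj₂ g = inj₂ λ { zero → b ; (suc i) → g i }

-- Removing a prime from a covering number

unshift : ∀ {L n z a} j → n ∣ L → z ℤ.+ + (L * j) ∈ a [mod n ] → z ∈ a [mod n ]
unshift {n = n} {z} {a} j (divides q refl) (x , eq) =
  x ℤ.- + (q * j) ,
  trans (move z (+ (q * n * j)) (a ℤ.+ + n ℤ.* x) eq)
    (trans (cong (λ y → a ℤ.+ + n ℤ.* x ℤ.- y) qnj) (rearrange a (+ n) x (+ (q * j))))
  where
  move : ∀ z l y → z ℤ.+ l ≡ y → z ≡ y ℤ.- l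
  move z l _ refl = ring z l
    where
    ring : ∀ z l → z ≡ z ℤ.+ l ℤ.- l
    ring = ℤ.solve-∀

  qnj : + (q * n * j) ≡ + n ℤ.* + (q * j)
  qnj = trans (cong +_ (ring q n j)) (ℤ.pos-* n (q * j))
    where
    ring : ∀ q n j → q * n * j ≡ n * (q * j)
    ring = ℕ.solve-∀

  rearrange : ∀ a n x y → a ℤ.+ n ℤ.* x ℤ.- n ℤ.* y ≡ a ℤ.+ n ℤ.* (x ℤ.- y)
  rearrange = ℤ.solve-∀

sameClass⇒∣ : ∀ {n a z u v} → z ℤ.+ + u ∈ a [mod n ] → z ℤ.+ + v ∈ a [mod n ] → u ≤ v → n ∣ v ∸ u
sameClass⇒∣ {n} {a} {z} {u} {v} (x , eq) (y , eq′) u≤v = divides ∣ y ℤ.- x ∣ (begin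
  v ∸ u                            ≡⟨ cong ∣_∣ (ℤ.⊖-≥ u≤v) ⟨
  ∣ v ℤ.⊖ u ∣                      ≡⟨ cong ∣_∣ (ℤ.m-n≡m⊖n v u) ⟨
  ∣ + v ℤ.- + u ∣                  ≡⟨ cong ∣_∣ (cancelˡ z (+ v) (+ u)) ⟩
  ∣ (z ℤ.+ + v) ℤ.- (z ℤ.+ + u) ∣  ≡⟨ cong₂ (λ s t → ∣ s ℤ.- t ∣) eq′ eq ⟩
  ∣ (a ℤ.+ + n ℤ.* y) ℤ.- (a ℤ.+ + n ℤ.* x) ∣ ≡⟨ cong ∣_∣ (factor a (+ n) x y) ⟩
  ∣ (y ℤ.- x) ℤ.* + n ∣            ≡⟨ ℤ.abs-* (y ℤ.- x) (+ n) ⟩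
  ∣ y ℤ.- x ∣ * n                  ∎)
  where
  open ≡-Reasoning

  cancelˡ : ∀ z v u → v ℤ.- u ≡ (z ℤ.+ v) ℤ.- (z ℤ.+ u)
  cancelˡ = ℤ.solve-∀

  factor : ∀ a n x y → (a ℤ.+ n ℤ.* y) ℤ.- (a ℤ.+ n ℤ.* x) ≡ (y ℤ.- x) ℤ.* n
  factor = ℤ.solve-∀

-- The difference is `m * (v ∸ u) * p ^ i`; if `p ^ suc i` divided it, `p` would divide `m` or
-- `v ∸ u`, but `0 < v ∸ u < p`.
translate-∤ : ∀ {p m ν u v} → Prime p → p ∤ m → ∀ i → p ^ suc i ∣ ν → u < v → v < p →
              ν ∤ m * p ^ i * v ∸ m * p ^ i * u
translate-∤ {p} {m} {ν} {u} {v} pp p∤m i p∣ν u<v v<p ν∣ with euclidsLemma m (v ∸ u) pp p∣m*[v∸u]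
  where
  regroup : m * p ^ i * v ∸ m * p ^ i * u ≡ m * (v ∸ u) * p ^ i
  regroup = trans (sym (*-distribˡ-∸ (m * p ^ i) v u)) (ring m (p ^ i) (v ∸ u))
    where
    ring : ∀ m q d → m * q * d ≡ m * d * q
    ring = ℕ.solve-∀

  p∣m*[v∸u] : p ∣ m * (v ∸ u)
  p∣m*[v∸u] = *-cancelʳ-∣ (p ^ i) {{m^n≢0 p i {{prime⇒nonZero pp}}}}
                (subst (p ^ suc i ∣_) regroup (∣-trans p∣ν ν∣))
... | inj₁ p∣m = p∤m p∣m
... | inj₂ p∣d = >⇒∤ {{>-nonZero (m<n⇒0<n∸m u<v)}} (≤-<-trans (m∸n≤m v u) v<p) p∣d

-- A point z missed by the moduli dividing L = m * p ^ i would have all of its p translates z + L * j covered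
-- by moduli e * p ^ (i + 1) with e ∣ m; there are fewer than p of these, and no class of
-- such a modulus contains two of the translates.
reduce : ∀ {p m n} → Prime p → p ∤ m → AtMostDivisors m n → n < p → ∀ i →
         HasCover (m * p ^ suc i) → HasCover (m * p ^ i)
reduce {p} {m} {n} pp p∤m (f , complete) n<p i (a , cover) = a , cover′
  where
  L = m * p ^ i

  Hit : ℤ → Fin p → Fin n → Set
  Hit z j k = z ℤ.+ + (L * toℕ j) ∈ a (f k * p ^ suc i) [mod f k * p ^ suc i ]

  classify : ∀ z j → CoveredBy a L z ⊎ ∃ (Hit z j)
  classify z j with ν , 1<ν , ν∣ , z∈ ← cover (z ℤ.+ + (L * toℕ j))
               with e , t , e∣m , t≤ , refl ← ∣m*p^i pp m (suc i) ν∣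
               with m≤n⇒m<n∨m≡n t≤
  -- Such a modulus divides `L`, so the shift by a multiple of `L` is invisible to it and `z` itself
  -- is covered.
  ... | inj₁ (s≤s t≤i) =
    inj₁ (e * p ^ t , 1<ν , ν∣L , unshift {a = a (e * p ^ t)} (toℕ j) ν∣L z∈)
    where ν∣L = *-pres-∣ e∣m (^-monoʳ-∣ p t≤i)
  ... | inj₂ refl with k , refl ← complete e∣m = inj₂ (k , z∈)

  collide : ∀ z {j j′ k} → toℕ j < toℕ j′ → Hit z j k → ¬ Hit z j′ k
  collide z {j} {j′} {k} j<j′ h h′ =
    translate-∤ pp p∤m i (n∣m*n (f k)) j<j′ (toℕ<n j′)
      (sameClass⇒∣ {a = a (f k * p ^ suc i)} {z} h h′ (*-monoʳ-≤ L (<⇒≤ j<j′)))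

  cover′ : ∀ z → CoveredBy a L z
  cover′ z with all⊎ (classify z)
  ... | inj₁ covered = covered
  ... | inj₂ hits with j , j′ , j<j′ , k≡k′ ← pigeonhole n<p (proj₁ ∘ hits) =
    ⊥-elim (collide z j<j′ (proj₂ (hits j)) (subst (Hit z j′) (sym k≡k′) (proj₂ (hits j′))))

reduce* : ∀ {p m n} → Prime p → p ∤ m → AtMostDivisors m n → n < p → ∀ i →
          HasCover (m * p ^ i) → HasCover m
reduce* {m = m} pp p∤m atMost n<p zero    c = subst HasCover (*-identityʳ m) c
reduce* pp p∤m atMost n<p (suc i) c = reduce* pp p∤m atMost n<p i (reduce pp p∤m atMost n<p i c)

-- Building covers

reassign : ∀ {n} (a : ℕ → ℤ) (ν : Fin n → ℕ) → Injective _≡_ _≡_ ν → (b : Fin n → ℤ) →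
           ∃ λ a′ → (∀ {m} → (∀ k → ν k ≢ m) → a′ m ≡ a m) × (∀ k → a′ (ν k) ≡ b k)
reassign a ν ν-inj b = a′ , outside , inside
  where
  a′ : ℕ → ℤ
  a′ m with any? (λ k → ν k ≟ m)
  ... | yes (k , _) = b k
  ... | no  _       = a m

  outside : ∀ {m} → (∀ k → ν k ≢ m) → a′ m ≡ a m
  outside {m} ν≢m with any? (λ k → ν k ≟ m)
  ... | yes (k , νk≡m) = contradiction νk≡m (ν≢m k)
  ... | no  _          = refl

  inside : ∀ k → a′ (ν k) ≡ b k
  inside k with any? (λ l → ν l ≟ ν k)
  ... | yes (l , eq) = cong b (ν-inj eq)
  ... | no  ∄        = contradiction (k , refl) ∄

-- `N` and `M` differ midway through an extension: the moduli already divide the next number while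
-- the exempt integers are still the multiples of the old one.
CoversOutsideMultiples : (ℕ → ℤ) → ℕ → ℕ → Set
CoversOutsideMultiples a N M = ∀ z → CoveredBy a N z ⊎ ∃ λ x → z ≡ + M ℤ.* x

NearCover : ℕ → Set
NearCover M = ∃ λ a → CoversOutsideMultiples a M M

-- With M = m * p ^ i, the moduli f k * p ^ (i + 1) do not divide M, so the class of M * c k modulo each
-- of them can be added to a near cover; it contains M * x for every x ≡ c k (mod p).
addClasses : ∀ {p m n} → Prime p → p ∤ m → AtLeastDivisors m n → ∀ i → NearCover (m * p ^ i) → (c : Fin n → ℕ) →
             ∃ λ a → CoversOutsideMultiples a (m * p ^ suc i) (m * p ^ i) ×
                     (∀ k y → CoveredBy a (m * p ^ suc i) (+ (m * p ^ i) ℤ.* (+ c k ℤ.+ y ℤ.* + p)))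
addClasses {p} {m} {n} pp p∤m (f , f-inj , f∣m) i (a , near) c
  with a′ , outside , inside ← reassign a (λ k → f k * p ^ suc i)
         (λ {k} {l} eq → f-inj (*-cancelʳ-≡ (f k) (f l) (p ^ suc i) {{m^n≢0 p (suc i) {{prime⇒nonZero pp}}}} eq))
         (λ k → + (m * p ^ i * c k))
  = a′ , old , new
  where
  instance
    p≢0 : NonZero p
    p≢0 = prime⇒nonZero pp

    pⁱ≢0 : NonZero (p ^ i)
    pⁱ≢0 = m^n≢0 p i

  ν : Fin n → ℕ
  ν k = f k * p ^ suc i

  ν≢ : ∀ {d} → d ∣ m * p ^ i → ∀ k → ν k ≢ d
  ν≢ d∣M k refl = p∤m (*-cancelʳ-∣ (p ^ i) (∣-trans (n∣m*n (f k)) d∣M))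

  1<ν : ∀ k → 1 < ν k
  1<ν k = <-≤-trans (nonTrivial⇒n>1 p {{prime⇒nonTrivial pp}}) (∣⇒≤ {{ν≢0}} (∣n⇒∣m*n (f k) (m∣m*n (p ^ i))))
    where
    ν≢0 : NonZero (ν k)
    ν≢0 = m*n≢0 (f k) (p ^ suc i)
            -- `f k ≡ 0` would force `m ≡ 0`, which `p` divides.
            {{≢-nonZero λ fk≡0 → p∤m (subst (p ∣_) (sym (0∣⇒≡0 (subst (_∣ m) fk≡0 (f∣m k)))) (p ∣0))}}
            {{m^n≢0 p (suc i)}}

  old : CoversOutsideMultiples a′ (m * p ^ suc i) (m * p ^ i)
  old z with near z
  ... | inj₂ multiple = inj₂ multiple
  ... | inj₁ (d , 1<d , d∣M , z∈) =
    inj₁ (d , 1<d , ∣-trans d∣M (*-monoʳ-∣ m (n∣m*n p)) , subst (λ b → z ∈ b [mod d ]) (sym (outside (ν≢ d∣M))) z∈)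

  new : ∀ k y → CoveredBy a′ (m * p ^ suc i) (+ (m * p ^ i) ℤ.* (+ c k ℤ.+ y ℤ.* + p))
  new k y with divides q m≡ ← f∣m k =
    -- Since `m ≡ q * f k`, the product of `m * p ^ i` and `p` is `ν k * q`; hence the witness
    -- `q * y`.
    ν k , 1<ν k , *-monoˡ-∣ (p ^ suc i) (f∣m k) , + q ℤ.* y ,
    trans (expand (+ (m * p ^ i)) (+ c k) y (+ p))
      (cong₂ ℤ._+_ (trans (sym (ℤ.pos-* (m * p ^ i) (c k))) (sym (inside k)))
                   (trans (cong (ℤ._* y) Mp≡νq) (ℤ.*-assoc (+ ν k) (+ q) y)))
    where
    expand : ∀ M c y p → M ℤ.* (c ℤ.+ y ℤ.* p) ≡ M ℤ.* c ℤ.+ M ℤ.* p ℤ.* y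
    expand = ℤ.solve-∀

    Mp≡νq : + (m * p ^ i) ℤ.* + p ≡ + ν k ℤ.* + q
    Mp≡νq = trans (sym (ℤ.pos-* (m * p ^ i) p))
              (trans (cong +_ (trans (cong (λ m → m * p ^ i * p) m≡) (ring q (f k) (p ^ i) p))) (ℤ.pos-* (ν k) q))
      where
      ring : ∀ q f u p → q * f * u * p ≡ f * (p * u) * q
      ring = ℕ.solve-∀

-- With `c k = k` and `p ≤ n`, the added classes reach every remainder modulo `p`.
completeCover : ∀ {p m n} → Prime p → p ∤ m → AtLeastDivisors m n → p ≤ n → ∀ i →
                NearCover (m * p ^ i) → HasCover (m * p ^ suc i)
completeCover {p} {m} pp p∤m atLeast p≤n i near with a , old , new ← addClasses pp p∤m atLeast i near toℕ = a , cover
  where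
  instance
    p≢0 : NonZero p
    p≢0 = prime⇒nonZero pp

  cover : ∀ z → CoveredBy a (m * p ^ suc i) z
  cover z with old z
  ... | inj₁ covered    = covered
  ... | inj₂ (x , refl) =
    subst (λ x → CoveredBy a (m * p ^ suc i) (+ (m * p ^ i) ℤ.* x))
      (trans (cong (λ r → + r ℤ.+ x ℤ./ℕ p ℤ.* + p) (toℕ-fromℕ< r<n)) (sym (ℤ.a≡a%ℕn+[a/ℕn]*n x p)))
      (new (fromℕ< r<n) (x ℤ./ℕ p))
    where r<n = <-≤-trans (ℤ.n%ℕd<d x p) p≤n

-- With `c k = k + 1`, the `p - 1` added classes reach exactly the nonzero remainders modulo `p`;
-- remainder `0` leaves the multiples of `m * p ^ suc i`.
extendNearCover : ∀ {m n} → Prime (suc n) → suc n ∤ m → AtLeastDivisors m n → ∀ i →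
                  NearCover (m * suc n ^ i) → NearCover (m * suc n ^ suc i)
extendNearCover {m} {n} pp p∤m atLeast i near with a , old , new ← addClasses pp p∤m atLeast i near (suc ∘ toℕ) = a , cover
  where
  p = suc n

  M*[y*p] : ∀ y → + (m * p ^ i) ℤ.* (+ 0 ℤ.+ y ℤ.* + p) ≡ + (m * p ^ suc i) ℤ.* y
  M*[y*p] y = trans (ring (+ (m * p ^ i)) y (+ p))
                (cong (ℤ._* y) (trans (sym (ℤ.pos-* (m * p ^ i) p)) (cong +_ (regroup m (p ^ i) p))))
    where
    ring : ∀ M y p → M ℤ.* (+ 0 ℤ.+ y ℤ.* p) ≡ M ℤ.* p ℤ.* y
    ring = ℤ.solve-∀

    regroup : ∀ m u p → m * u * p ≡ m * (p * u)
    regroup = ℕ.solve-∀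

  remainder : ∀ r y → r < p → let z = + (m * p ^ i) ℤ.* (+ r ℤ.+ y ℤ.* + p) in
              CoveredBy a (m * p ^ suc i) z ⊎ ∃ λ x → z ≡ + (m * p ^ suc i) ℤ.* x
  remainder zero    y _         = inj₂ (y , M*[y*p] y)
  remainder (suc r) y (s≤s r<n) =
    inj₁ (subst (λ r → CoveredBy a (m * p ^ suc i) (+ (m * p ^ i) ℤ.* (+ suc r ℤ.+ y ℤ.* + p)))
            (toℕ-fromℕ< r<n) (new (fromℕ< r<n) y))

  cover : CoversOutsideMultiples a (m * p ^ suc i) (m * p ^ suc i)
  cover z with old z
  ... | inj₁ covered    = inj₁ covered
  ... | inj₂ (x , refl) =
    subst (λ x → CoveredBy a (m * p ^ suc i) (+ (m * p ^ i) ℤ.* x) ⊎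
                 ∃ λ y → + (m * p ^ i) ℤ.* x ≡ + (m * p ^ suc i) ℤ.* y)
      (sym (ℤ.a≡a%ℕn+[a/ℕn]*n x p)) (remainder (x ℤ.%ℕ p) (x ℤ./ℕ p) (ℤ.n%ℕd<d x p))

extendNearCover* : ∀ {m n} → Prime (suc n) → suc n ∤ m → AtLeastDivisors m n → ∀ i →
                   NearCover m → NearCover (m * suc n ^ i)
extendNearCover* {m} pp p∤m atLeast zero    near = subst NearCover (sym (*-identityʳ m)) near
extendNearCover* pp p∤m atLeast (suc i) near =
  extendNearCover pp p∤m atLeast i (extendNearCover* pp p∤m atLeast i near)

-- The inductive step on the number of primes

-- For M the product of the first prime powers, P is the next prime and T the number of divisors of M.
record Stage (P T M : ℕ) : Set where
  field
    near    : NearCover M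
    lower   : AtLeastDivisors M T
    upper   : AtMostDivisors M T
    primes  : ∀ {q} → Prime q → q ∣ M → q < P
    noCover : ∀ {d} → d ∣ M → ¬ HasCover d

  ∤ : ∀ {p} → Prime p → P ≤ p → p ∤ M
  ∤ pp P≤p p∣M = <⇒≱ (primes pp p∣M) P≤p

prime∣^⇒≡ : ∀ {p q} → Prime p → Prime q → ∀ i → q ∣ p ^ i → q ≡ p
prime∣^⇒≡ pp pq zero    q∣1 = contradiction (subst Prime (∣1⇒≡1 q∣1) pq) ¬prime[1]
prime∣^⇒≡ {p} pp pq (suc i) q∣ with euclidsLemma p (p ^ i) pq q∣
... | inj₂ q∣pⁱ = prime∣^⇒≡ pp pq i q∣pⁱ
... | inj₁ q∣p with prime⇒irreducible pp q∣p
...   | inj₁ refl = contradiction pq ¬prime[1]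
...   | inj₂ q≡p  = q≡p

-- Every integer is a multiple of the empty product `1`, so all are exempt; its single divisor
-- matches `2 - 1`.
stage₀ : Stage 2 1 1
stage₀ = record
  { near    = (λ _ → + 0) , λ z → inj₂ (z , sym (ℤ.*-identityˡ z))
  ; lower   = (λ _ → 1) , (λ { {zero} {zero} _ → refl }) , λ _ → ∣-refl
  ; upper   = (λ _ → 1) , λ d∣1 → zero , sym (∣1⇒≡1 d∣1)
  ; primes  = λ pq q∣1 → contradiction (subst Prime (∣1⇒≡1 q∣1) pq) ¬prime[1]
  ; noCover = λ d∣1 → 1-hasNoCover ∘ subst HasCover (∣1⇒≡1 d∣1)
  }

-- A divisor count exactly one below the prime is the balance point: enough to extend the near
-- cover, too few for the prime to help complete it.
stage-*^ : ∀ {T M P′} → Prime (suc T) → suc T < P′ → Stage (suc T) T M → ∀ i →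
           Stage P′ (T * suc i) (M * suc T ^ i)
stage-*^ {T} {M} {P′} pP P<P′ S i = record
  { near    = extendNearCover* pP P∤M lower i near
  ; lower   = atLeast-*^ pP P∤M i lower
  ; upper   = atMost-*^ pP i upper
  ; primes  = primes′
  ; noCover = noCover′
  }
  where
  open Stage S
  P∤M = ∤ pP ≤-refl

  primes′ : ∀ {q} → Prime q → q ∣ M * suc T ^ i → q < P′
  primes′ pq q∣ with euclidsLemma M (suc T ^ i) pq q∣
  ... | inj₁ q∣M = <-trans (primes pq q∣M) P<P′
  ... | inj₂ q∣Pⁱ with refl ← prime∣^⇒≡ pP pq i q∣Pⁱ = P<P′

  noCover′ : ∀ {d} → d ∣ M * suc T ^ i → ¬ HasCover d
  noCover′ d∣ with e , j , e∣M , _ , refl ← ∣m*p^i pP M i d∣ =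
    noCover e∣M ∘ reduce* pP (λ P∣e → P∤M (∣-trans P∣e e∣M)) (atMost-∣ e∣M upper) ≤-refl j

-- A proper divisor is `e * p ^ j` with `j ≤ 1`. If `e ≢ M`, few divisors allow `p` to be removed;
-- if `e ≡ M`, then `j ≡ 0`. Either way `noCover` applies.
stage⇒primitive : ∀ {p T M} → Prime p → p ≤ T → Stage p T M →
                  (∀ {e} → e ∣ M → e ≢ M → ∃ λ n → n < p × AtMostDivisors e n) →
                  PrimitiveCoveringNumber (M * p)
stage⇒primitive {p} {T} {M} pp p≤T S fewDivisors = hasCover⇒covering 0<Mp covers , minimal
  where
  open Stage S
  instance
    p≢0 : NonZero p
    p≢0 = prime⇒nonZero pp

  p∤M = ∤ pp ≤-refl

  M*p^1≡M*p : M * p ^ 1 ≡ M * p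
  M*p^1≡M*p = cong (M *_) (^-identityʳ p)

  0<Mp : 0 < M * p
  0<Mp = n≢0⇒n>0 λ Mp≡0 → p∤M (subst (p ∣_) (sym (*-cancelʳ-≡ M 0 p Mp≡0)) (p ∣0))

  covers : HasCover (M * p)
  covers = subst HasCover M*p^1≡M*p
    (completeCover pp p∤M lower p≤T 0 (subst NearCover (sym (*-identityʳ M)) near))

  minimal : ∀ d → 0 < d → d < M * p → d ∣ M * p → ¬ CoveringNumber d
  minimal d _ d<Mp d∣Mp cov
    with e , j , e∣M , j≤1 , refl ← ∣m*p^i pp M 1 (subst (d ∣_) (sym M*p^1≡M*p) d∣Mp)
    with e ≟ M
  ... | no e≢M = let n , n<p , atMost = fewDivisors e∣M e≢M
                 in noCover e∣M (reduce* pp (λ p∣e → p∤M (∣-trans p∣e e∣M)) atMost n<p j (covering⇒hasCover cov))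
  ... | yes refl with j≤1
  ...   | z≤n     = noCover ∣-refl (subst HasCover (*-identityʳ e) (covering⇒hasCover cov))
  ...   | s≤s z≤n = <-irrefl M*p^1≡M*p d<Mp

-- A proper divisor either loses a factor `suc T`, so that only `i` exponents remain, or keeps the
-- full power and loses the divisor `M` of its cofactor.
fewDivisors-*^ : ∀ {T M p} → Prime (suc T) → 0 < M → AtMostDivisors M T → ∀ i →
                 T * i < p → (T ∸ 1) * suc i < p →
                 ∀ {e} → e ∣ M * suc T ^ i → e ≢ M * suc T ^ i → ∃ λ n → n < p × AtMostDivisors e n
fewDivisors-*^ {T} {M} pP 0<M upper i Ti<p [T-1][1+i]<p e∣ e≢
  with e′ , j , e′∣M , j≤i , refl ← ∣m*p^i pP M i e∣
  with m≤n⇒m<n∨m≡n j≤i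
... | inj₁ j<i@(s≤s {n = i-1} j≤i-1) =
  T * i , Ti<p , atMost-∣ (*-pres-∣ e′∣M (^-monoʳ-∣ (suc T) j≤i-1)) (atMost-*^ pP i-1 upper)
... | inj₂ refl =
  (T ∸ 1) * suc i , [T-1][1+i]<p ,
  atMost-*^ pP i (atMost-proper 0<M e′∣M (λ e′≡M → e≢ (cong (_* suc T ^ i) e′≡M)) upper)

-- Arithmetic of the exponents

¬prime-* : ∀ {m n} → 1 < m → 1 < n → ¬ Prime (m * n)
¬prime-* {m} {n} 1<m 1<n pmn with prime⇒irreducible pmn {m} (m∣m*n n)
... | inj₁ refl = <-irrefl refl 1<m
... | inj₂ m≡mn = <-irrefl (*-cancelˡ-≡ 1 n m {{>-nonZero (<-trans (s≤s z≤n) 1<m)}} (trans (*-identityʳ m) m≡mn)) 1<n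

÷-exact : ∀ {m n} → 0 < n → n ∣ m → ⌊ m ÷ n ⌋ * n ≡ m
÷-exact {n = suc n} _ n∣m = m/n*n≡m n∣m

÷-floor : ∀ m {n} → 0 < n → ∃ λ ρ → ρ < n × m ≡ ρ + ⌊ m ÷ n ⌋ * n
÷-floor m {suc n} _ = m % suc n , m%n<n m (suc n) , m≡m%n+[m/n]*n m (suc n)

-- With k = f + u + 1 and q = k + 2, the bounds leave only p = (q - 2)² (u = 0) and
-- p = (q - 2) (q - 3) (u = 1), and these are not primes larger than q.
noLargePrime : ∀ {p} f ρ u → ρ ≤ u → Prime p → p ≡ suc (ρ + f * suc (suc (f + u))) →
             suc (f + u) * (f + u) ≤ p → ¬ (suc (suc (suc (f + u))) < p)
noLargePrime zero    zero zero    _ pp refl _ _ = ¬prime[1] pp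
noLargePrime (suc f) zero zero    _ pp refl _ _ =
  ¬prime-* {2 + f} {2 + f} (s≤s (s≤s z≤n)) (s≤s (s≤s z≤n)) (subst Prime (square f) pp)
  where
  square : ∀ f → suc (suc f * suc (suc (suc f + 0))) ≡ suc (suc f) * suc (suc f)
  square = ℕ.solve-∀
-- Here `p + 1 ≡ k * (k ∸ 1)`: the size condition fails by one.
noLargePrime f zero (suc zero) _ _ refl q≤p _ = <-irrefl refl (subst (_≤ suc (f * suc (suc (f + 1)))) (excess f) q≤p)
  where
  excess : ∀ f → suc (f + 1) * (f + 1) ≡ suc (suc (f * suc (suc (f + 1))))
  excess = ℕ.solve-∀
noLargePrime zero    (suc zero) (suc zero) _ _  refl _ (s≤s (s≤s ()))
noLargePrime (suc f) (suc zero) (suc zero) _ pp refl _ _ =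
  ¬prime-* {2 + f} {3 + f} (s≤s (s≤s z≤n)) (s≤s (s≤s z≤n)) (subst Prime (factor f) pp)
  where
  factor : ∀ f → suc (suc (suc f * suc (suc (suc f + 1)))) ≡ suc (suc f) * suc (suc (suc f))
  factor = ℕ.solve-∀
noLargePrime _ (suc (suc _)) (suc zero) (s≤s ())
-- From here on even the largest admissible `ρ` leaves `p` below `k * (k ∸ 1)`.
noLargePrime f ρ (suc (suc u)) ρ≤2+u _ refl q≤p _ = <⇒≱ p<q q≤p
  where
  open ≤-Reasoning
  excess : ∀ f u → suc (f + suc (suc u)) * (f + suc (suc u)) ≡
                   suc (suc (suc u) + f * suc (suc (f + suc (suc u)))) + suc (f * suc u + u * u + 4 * u + 2)
  excess = ℕ.solve-∀

  p<q : suc (ρ + f * suc (suc (f + suc (suc u)))) < suc (f + suc (suc u)) * (f + suc (suc u))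
  p<q = begin-strict
    suc (ρ + f * suc (suc (f + suc (suc u))))             ≤⟨ s≤s (+-monoˡ-≤ _ ρ≤2+u) ⟩
    suc (suc (suc u) + f * suc (suc (f + suc (suc u))))   <⟨ m<m+n _ (s≤s z≤n) ⟩
    _                                                     ≡⟨ excess f u ⟨
    suc (f + suc (suc u)) * (f + suc (suc u))             ∎

-- This is where the size condition enters, with `q = k + 2`. Comparing `k + k * f` with
-- `ρ + f + k * f` settles `k ≤ ρ + f`; otherwise `k = f + u + 1` with `ρ ≤ u`, which `noLargePrime`
-- excludes.
k*[1+f]<p : ∀ {p k f ρ} → Prime p → p ≡ suc (ρ + f * suc k) → k * (k ∸ 1) ≤ p → suc (suc k) < p →
            k * suc f < p
k*[1+f]<p {p} {k} {f} {ρ} pp p≡ k[k-1]≤p 2+k<p with k ≤? ρ + f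
... | yes k≤ρ+f = subst (k * suc f <_) (sym p≡) (s≤s (begin
  k * suc f        ≡⟨ *-suc k f ⟩
  k + k * f        ≤⟨ +-monoˡ-≤ (k * f) k≤ρ+f ⟩
  ρ + f + k * f    ≡⟨ ring ρ f k ⟩
  ρ + f * suc k    ∎))
  where
  open ≤-Reasoning
  ring : ∀ ρ f k → ρ + f + k * f ≡ ρ + f * suc k
  ring = ℕ.solve-∀
... | no k≰ρ+f with u , refl ← m≤n⇒∃[o]m+o≡n (≤-<-trans (m≤n+m f ρ) (≰⇒> k≰ρ+f)) =
  ⊥-elim (noLargePrime f ρ u (+-cancelʳ-≤ f ρ u (subst (ρ + f ≤_) (+-comm f u) (≤-pred (≰⇒> k≰ρ+f)))) pp p≡ k[k-1]≤p 2+k<p)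

-- Chaining the stages along the primes

∏₁-suc : ∀ n f → ∏₁ (suc n) f ≡ ∏₁ n f * f (suc n)
∏₁-suc n f = begin
  product (applyUpTo (f ∘ suc) (suc n))                ≡⟨ cong product (applyUpTo-∷ʳ (f ∘ suc) n) ⟨
  product (applyUpTo (f ∘ suc) n ∷ʳ f (suc n))         ≡⟨ product-++ (applyUpTo (f ∘ suc) n) _ ⟩
  ∏₁ n f * (f (suc n) * 1)                             ≡⟨ cong (∏₁ n f *_) (*-identityʳ (f (suc n))) ⟩
  ∏₁ n f * f (suc n)                                   ∎
  where open ≡-Reasoning

-- Raising `P` to the quotient minus one multiplies the divisor count `P ∸ 1` by the quotient,
-- giving `P′ ∸ 1`: the counts telescope.
stage-next : ∀ {P P′ M} → Prime P → P < P′ → (P ∸ 1) ∣ (P′ ∸ 1) → Stage P (P ∸ 1) M →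
             Stage P′ (P′ ∸ 1) (M * P ^ (⌊ P′ ∸ 1 ÷ P ∸ 1 ⌋ ∸ 1))
stage-next {zero}        pP = contradiction pP ¬prime[0]
stage-next {suc zero}    pP = contradiction pP ¬prime[1]
stage-next {suc (suc k)} {P′} {M} pP P<P′ T∣P′-1 S =
  subst (λ T′ → Stage P′ T′ (M * suc (suc k) ^ (h ∸ 1))) T*[1+[h-1]] (stage-*^ pP P<P′ S (h ∸ 1))
  where
  h = ⌊ P′ ∸ 1 ÷ suc k ⌋

  hT≡P′-1 : h * suc k ≡ P′ ∸ 1
  hT≡P′-1 = ÷-exact (s≤s z≤n) T∣P′-1

  h≢0 : h ≢ 0
  -- Needed so that the truncated `h ∸ 1` satisfies `suc (h ∸ 1) ≡ h`.
  h≢0 h≡0 = <⇒≢ (m<n⇒0<n∸m (<-trans (s≤s (s≤s z≤n)) P<P′)) (trans (sym (cong (_* suc k) h≡0)) hT≡P′-1)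

  T*[1+[h-1]] : suc k * suc (h ∸ 1) ≡ P′ ∸ 1
  T*[1+[h-1]] = trans (cong (suc k *_) (m+[n∸m]≡n (n≢0⇒n>0 h≢0))) (trans (*-comm (suc k) h) hT≡P′-1)

-- Without the subtracted one, the divisor count is the first multiple of `q ∸ 1` that is at least
-- `p`, so the cover can be completed.
stage-final : ∀ {q p M} → Prime q → Prime p → q < p → (q ∸ 2) * (q ∸ 3) ≤ p → Stage q (q ∸ 1) M →
              PrimitiveCoveringNumber (M * q ^ ⌊ p ∸ 1 ÷ q ∸ 1 ⌋ * p)
stage-final {zero}        pq = contradiction pq ¬prime[0]
stage-final {suc zero}    pq = contradiction pq ¬prime[1]
stage-final {suc (suc k)} {p} {M} pq pp q<p [q-2][q-3]≤p S
  with ρ , ρ<T , p-1≡ ← ÷-floor (p ∸ 1) {suc k} (s≤s z≤n) =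
  stage⇒primitive pp p≤T[1+f] (stage-*^ pq q<p S f)
    (fewDivisors-*^ pq 0<M (Stage.upper S) f Tf<p
      (k*[1+f]<p pp p≡ [q-2][q-3]≤p q<p))
  where
  open ≤-Reasoning
  f = ⌊ p ∸ 1 ÷ suc k ⌋

  p≡ : p ≡ suc (ρ + f * suc k)
  p≡ = trans (sym (m+[n∸m]≡n (<-trans (s≤s z≤n) q<p))) (cong suc p-1≡)

  p≤T[1+f] : p ≤ suc k * suc f
  p≤T[1+f] = begin
    p                     ≡⟨ p≡ ⟩
    suc ρ + f * suc k     ≤⟨ +-monoˡ-≤ (f * suc k) ρ<T ⟩
    suc k + f * suc k     ≡⟨ *-comm (suc f) (suc k) ⟩
    suc k * suc f         ∎

  Tf<p : suc k * f < p
  Tf<p = begin-strict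
    suc k * f             ≡⟨ *-comm (suc k) f ⟩
    f * suc k             ≤⟨ m≤n+m (f * suc k) ρ ⟩
    ρ + f * suc k         <⟨ n<1+n _ ⟩
    suc (ρ + f * suc k)   ≡⟨ p≡ ⟨
    p                     ∎

  0<M : 0 < M
  0<M = n≢0⇒n>0 λ { refl → Stage.∤ S pq ≤-refl (suc (suc k) ∣0) }

theorem1p3 : (r : ℕ) → r > 1 →
    (p : ℕ → ℕ) →
    (∀ t → 1 ≤ t → t ≤ r → Prime (p t)) →
    p 1 ≡ 2 →
    (∀ t → 1 ≤ t → t < r → p t < p (t + 1)) →
    (∀ t → 0 < t → t < r ∸ 1 → (p t ∸ 1) ∣ (p (t + 1) ∸ 1)) →
    p r ≥ (p (r ∸ 1) ∸ 2) * (p (r ∸ 1) ∸ 3) →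
    PrimitiveCoveringNumber
    (∏₁ (r ∸ 2) (λ t → p t ^ (⌊ p (t + 1) ∸ 1 ÷ p t ∸ 1 ⌋ ∸ 1))
    * p (r ∸ 1) ^ ⌊ p r ∸ 1 ÷ p (r ∸ 1) ∸ 1 ⌋
    * p r)
theorem1p3 (suc zero) (s≤s ())
theorem1p3 (suc (suc n)) _ p prime p₁≡2 p< p-1∣ bound =
  stage-final (prime (suc n) (s≤s z≤n) (n≤1+n (suc n))) (prime (suc (suc n)) (s≤s z≤n) ≤-refl)
    (subst (λ t → p (suc n) < p t) (+-comm (suc n) 1) (p< (suc n) (s≤s z≤n) ≤-refl))
    bound (stage n ≤-refl)
  where
  factor : ℕ → ℕ
  factor t = p t ^ (⌊ p (t + 1) ∸ 1 ÷ p t ∸ 1 ⌋ ∸ 1)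

  -- As `r = n + 2`, the stages stop at `s = n`, where the next prime is `p (r ∸ 1)`; its power is
  -- left to `stage-final`.
  stage : ∀ s → s ≤ n → Stage (p (suc s)) (p (suc s) ∸ 1) (∏₁ s factor)
  stage zero    _   = subst (λ P → Stage P (P ∸ 1) 1) (sym p₁≡2) stage₀
  stage (suc s) s<n =
    subst₂ (λ t → Stage (p t) (p t ∸ 1)) (+-comm (suc s) 1) (sym (∏₁-suc s factor))
      (stage-next (prime (suc s) (s≤s z≤n) (m≤n⇒m≤1+n (≤-trans s<n (n≤1+n n))))
        (p< (suc s) (s≤s z≤n) (s≤s (m≤n⇒m≤1+n s<n)))
        (p-1∣ (suc s) (s≤s z≤n) (s≤s s<n))
        (stage s (<⇒≤ s<n)))
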